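{- Set $\mathrm{Single}(0,A)=\mathrm{Total}(0,A)=0$. Then for every $n\ge 1$: $\mathrm{Single}(n,A)$ equals the smallest $x\in A$ with $\mathrm{gap}(x)>\mathrm{Total}(n-1,A)$, or $\infty$ if there is no such $x$ (in which case also $\mathrm{Total}(n,A)=\infty$); and $\mathrm{Total}(n,A)=\mathrm{Single}(n,A)+\mathrm{Total}(n-1,A)=\sum_{i=1}^{n}\mathrm{Single}(i,A)$.
   Context: Let $A$ be a set of positive integers with $1\in A$ (the allowed tile values). For $x\in A$, let $\mathrm{gap}(x)=x'-x$ where $x'$ is the smallest element of $A$ greater than $x$, with $\mathrm{gap}(x)=\infty$ if $x=\max A$. For an integer $n\ge 0$, the abstract generalized 2048 game $\mathrm{AGG}(n,A)$ is played on $n$ indistinguishable cells. A position assigns to each cell either nothing (the cell is empty) or a tile carrying a value in $A$. The initial position has all cells empty. A step, which can be performed from any position having at least one empty cell, consists of: (i) placing a new tile of value $1$ into a chosen empty cell; then (ii) optionally choosing any collection of pairwise disjoint sets of nonempty cells such that the sum of the tile values in each chosen set belongs to $A$, and merging each chosen set into a single tile, whose value is that sum, placed in one cell of the set, the other cells of the set becoming empty. The game ends when, after a step, all cells are nonempty (no further step is then possible). A position is reachable if it can be obtained from the initial position by a finite sequence of steps; its total value is the sum of its tile values. For $n\ge1$, $\mathrm{Single}(n,A)$ is the supremum (possibly $\infty$) of the values $x\in A$ such that the position of $\mathrm{AGG}(n,A)$ with one tile of value $x$ and $n-1$ empty cells is reachable, and $\mathrm{Total}(n,A)$ is the supremum (possibly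 $\infty$) of the total values of reachable positions of $\mathrm{AGG}(n,A)$. -}

module Defs where

open import Axiom.ExcludedMiddle using (ExcludedMiddle)
open import Data.Bool.Base using (if_then_else_)
open import Data.Fin.Base using (Fin)
open import Data.Fin.Subset using (Subset; _∈_; _∉_; _∩_; Empty)
open import Data.Irrelevant using () renaming ([_] to irr)
open import Data.List.Base using (foldr; applyUpTo)
open import Data.Maybe.Base using (Maybe; just; nothing; maybe′)
open import Data.Nat.Base using (ℕ; zero; suc; _+_; _∸_; _≤_; _<_)
open import Data.Product.Base using (Σ-syntax; ∃; ∃-syntax; _×_; _,_)
open import Data.Refinement.Base using (Refinement; Refinement-syntax; value; _,_)
open import Data.Vec.Base using (Vec; lookup; replicate; sum; map; zipWith; _[_]≔_)
open import Level using (0ℓ)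
open import Relation.Binary.Construct.Closure.ReflexiveTransitive using (Star)
open import Relation.Binary.Construct.Add.Supremum.Strict _<_ public using (_<⁺_)
open import Relation.Binary.PropositionalEquality.Core using (_≡_; _≢_)
open import Relation.Nullary.Construct.Add.Supremum public using (_⁺; ⊤⁺; [_])
open import Relation.Nullary.Decidable.Core using (Dec; yes; no)
open import Relation.Unary using (Pred)

record TileSet : Set₁ where
  field
    Allowed  : Pred ℕ 0ℓ
    positive : ∀ {x} → Allowed x → 0 < x
    one      : Allowed 1

-- ℕ ⁺ plays the role of ℕ ∪ {∞}, with ∞ = ⊤⁺.

infixl 6 _+⁺_ _∸⁺_

_+⁺_ : ℕ ⁺ → ℕ ⁺ → ℕ ⁺
[ m ] +⁺ [ n ] = [ m + n ]
[ m ] +⁺ ⊤⁺    = ⊤⁺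
⊤⁺    +⁺ n     = ⊤⁺

_∸⁺_ : ℕ ⁺ → ℕ → ℕ ⁺
[ m ] ∸⁺ n = [ m ∸ n ]
⊤⁺    ∸⁺ n = ⊤⁺

sum⁺ : (ℕ → ℕ ⁺) → ℕ → ℕ ⁺
sum⁺ f n = foldr _+⁺_ [ 0 ] (applyUpTo f n)

IsSmallest : Pred ℕ 0ℓ → Pred ℕ 0ℓ
IsSmallest P m = P m × (∀ k → P k → m ≤ k)

UpperBound : Pred ℕ 0ℓ → Pred ℕ 0ℓ
UpperBound P b = ∀ x → P x → x ≤ b

module AGG (A : TileSet) where
  open TileSet A

  -- The proof component is irrelevant, so tiles with equal values are equal.
  Tile : Set
  Tile = [ x ∈ ℕ ∣ Allowed x ]

  Position : ℕ → Set
  Position n = Vec (Maybe Tile) n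

  cellValue : Maybe Tile → ℕ
  cellValue = maybe′ value 0

  total : ∀ {n} → Position n → ℕ
  total p = sum (map cellValue p)

  sumOver : ∀ {n} → Subset n → Position n → ℕ
  sumOver S p = sum (zipWith (λ inside t → if inside then cellValue t else 0) S p)

  initial : ∀ n → Position n
  initial n = replicate n nothing

  place : ∀ {n} x → Allowed x → Fin n → Position n → Position n
  place x x∈A c p = p [ c ]≔ just (x , irr x∈A)

  -- Merges p q: simultaneously merging each of the sets S i (k = 0 being
  -- allowed) turns p into q, the tile obtained from S i ending up in cell r i.
  record Merges {n : ℕ} (p q : Position n) : Set where
    field
      k         : ℕ
      S         : Fin k → Subset n
      disjoint  : ∀ i j → i ≢ j → Empty (S i ∩ S j)
      nonempty  : ∀ i c → c ∈ S i → lookup p c ≢ nothing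
      allowed   : ∀ i → Allowed (sumOver (S i) p)
      r         : Fin k → Fin n
      r∈S       : ∀ i → r i ∈ S i
      merged    : ∀ i → lookup q (r i) ≡ just (sumOver (S i) p , irr (allowed i))
      emptied   : ∀ i c → c ∈ S i → c ≢ r i → lookup q c ≡ nothing
      untouched : ∀ c → (∀ i → c ∉ S i) → lookup q c ≡ lookup p c

  Step : ∀ {n} → Position n → Position n → Set
  Step p q = ∃[ c ] (lookup p c ≡ nothing × Merges (place 1 one c p) q)

  Reachable : ∀ {n} → Position n → Set
  Reachable {n} p = Star Step (initial n) p

  -- Cells are labelled here, so "the" position with a single tile is only
  -- determined up to the choice of the cell c.
  ReachableSingle : ℕ → Pred ℕ 0ℓ
  ReachableSingle n x = Σ[ x∈A ∈ Allowed x ] ∃[ c ] Reachable (place x x∈A c (initial n))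

  ReachableTotal : ℕ → Pred ℕ 0ℓ
  ReachableTotal n t = ∃[ p ] (Reachable {n} p × total p ≡ t)

-- Smallest elements and suprema of arbitrary sets of naturals are not
-- computable, so functions returning them need excluded middle.
module Classical (em : ExcludedMiddle 0ℓ) where

  fromSmallest : ∀ {P} → Dec (∃ (IsSmallest P)) → ℕ ⁺
  fromSmallest (yes (m , _)) = [ m ]
  fromSmallest (no _)        = ⊤⁺

  -- Classically P has a smallest element unless it is empty.
  smallest : Pred ℕ 0ℓ → ℕ ⁺
  smallest P = fromSmallest {P} em

  sup : Pred ℕ 0ℓ → ℕ ⁺
  sup P = smallest (UpperBound P)

  module _ (A : TileSet) where
    open TileSet A
    open AGG A

    gap : ℕ → ℕ ⁺
    gap x = smallest (λ y → Allowed y × x < y) ∸⁺ x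

    Single : ℕ → ℕ ⁺
    Single zero        = [ 0 ]
    Single n@(suc _)   = sup (ReachableSingle n)

    Total : ℕ → ℕ ⁺
    Total zero      = [ 0 ]
    Total n@(suc _) = sup (ReachableTotal n)

    GapExceeds : ℕ ⁺ → Pred ℕ 0ℓ
    GapExceeds t x = Allowed x × t <⁺ gap x

{-# OPTIONS --safe #-}
-- Put T 0 = 0, S n = the least x ∈ A with gap x > T n, and T (n+1) = S n + T n.
--
-- Upper bound: in every reachable position the cells can be numbered injectively
-- by levels 0, …, n-1 so that the tile at level i is at most S i.  When a block of
-- cells with highest level m is merged, its sum lies in A and is at most
-- S m + T m < S m + gap (S m), hence at most S m, so the new tile may take level m.
--
-- Lower bound: a tile y ≤ S n is built from the preceding element y₀ of A, as
-- y - y₀ ≤ T n is a total that the n remaining cells can hold.  Putting the largest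
-- possible tile in one cell and playing on with the others yields every total up to T.
module Submission where

open import Axiom.ExcludedMiddle using (ExcludedMiddle)
open import Data.Fin.Base using (Fin; zero; suc; toℕ)
open import Data.Fin.Permutation.Components using (transpose; transpose-inverse)
open import Data.Fin.Properties using (any?; toℕ<n; toℕ-injective) renaming (_≟_ to _≟ᶠ_)
open import Data.Fin.Subset using (Subset; inside; outside; _∈_; _∉_) renaming (⊤ to full)
open import Data.Fin.Subset.Properties using (_∈?_; x∈p∩q⁺)
open import Data.Irrelevant using () renaming ([_] to irr)
open import Data.Maybe.Base using (just; nothing; is-just)
open import Data.Nat.Base using (ℕ; zero; suc; _+_; _∸_; _≤_; _<_; z≤n; s≤s; s≤s⁻¹)
open import Data.Nat.Induction using (<-rec)
open import Data.Nat.Properties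
open import Data.Product.Base using (∃; ∃-syntax; _×_; _,_; proj₁; proj₂)
open import Data.Refinement.Base using (_,_)
open import Data.Sum.Base using (_⊎_; inj₁; inj₂)
open import Data.Vec.Base using (_∷_; []; lookup; map; here; there; _[_]≔_)
open import Data.Vec.Properties
  using (lookup∘update; lookup∘update′; lookup-replicate; []=⇒lookup; lookup⇒[]=)
open import Function.Base using (_∘_; id)
open import Function.Definitions using (Injective)
open import Level using (0ℓ)
open import Relation.Binary.Construct.Add.Supremum.NonStrict _≤_
  using (_≤⁺_; [_]; _≤⊤⁺; [≤]-injective; ≤⁺-trans)
open import Relation.Binary.Construct.Add.Supremum.Strict _<_ using ([_]; [_]<⊤⁺)
open import Relation.Binary.Construct.Closure.ReflexiveTransitive using (Star; ε; _◅_; _◅◅_; gmap)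
open import Relation.Binary.PropositionalEquality.Core
  using (_≡_; _≢_; refl; sym; trans; cong; cong₂; subst)
open import Relation.Nullary.Decidable using (Dec; yes; no; _×-dec_)
open import Relation.Nullary.Negation.Core using (¬_; contradiction)
open import Relation.Unary using (Pred)
open import Defs

-- Arithmetic with infinity.

≤⁺-refl : ∀ {s} → s ≤⁺ s
≤⁺-refl {[ k ]} = [ ≤-refl ]
≤⁺-refl {⊤⁺}    = ⊤⁺ ≤⊤⁺

+⁺-mono-≤⁺ : ∀ {a b s t} → [ a ] ≤⁺ s → [ b ] ≤⁺ t → [ a + b ] ≤⁺ s +⁺ t
+⁺-mono-≤⁺ [ p ]   [ q ]   = [ +-mono-≤ p q ]
+⁺-mono-≤⁺ [ p ]   (_ ≤⊤⁺) = _ ≤⊤⁺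
+⁺-mono-≤⁺ (_ ≤⊤⁺) _       = _ ≤⊤⁺

+⁺-comm : ∀ s t → s +⁺ t ≡ t +⁺ s
+⁺-comm [ m ] [ n ] = cong [_] (+-comm m n)
+⁺-comm [ m ] ⊤⁺    = refl
+⁺-comm ⊤⁺    [ n ] = refl
+⁺-comm ⊤⁺    ⊤⁺    = refl

+⁺-assoc : ∀ s t u → (s +⁺ t) +⁺ u ≡ s +⁺ (t +⁺ u)
+⁺-assoc [ l ] [ m ] [ n ] = cong [_] (+-assoc l m n)
+⁺-assoc [ l ] [ m ] ⊤⁺    = refl
+⁺-assoc [ l ] ⊤⁺    u     = refl
+⁺-assoc ⊤⁺    t     u     = refl

sum⁺-suc : ∀ f n → sum⁺ f (suc n) ≡ f n +⁺ sum⁺ f n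
sum⁺-suc f zero    = refl
sum⁺-suc f (suc n) =
  trans (cong (f 0 +⁺_) (sum⁺-suc (f ∘ suc) n))
  (trans (sym (+⁺-assoc (f 0) (f (suc n)) (sum⁺ (f ∘ suc) n)))
  (trans (cong (_+⁺ sum⁺ (f ∘ suc) n) (+⁺-comm (f 0) (f (suc n))))
         (+⁺-assoc (f (suc n)) (f 0) (sum⁺ (f ∘ suc) n))))

-- Transpositions and subsets of cells.

transpose-injective : ∀ {n} (i j : Fin n) → Injective _≡_ _≡_ (transpose i j)
transpose-injective i j eq =
  trans (sym (transpose-inverse j i)) (trans (cong (transpose j i) eq) (transpose-inverse j i))

transpose-closed : ∀ {n} {S : Subset n} {i j c} →
                   i ∈ S → j ∈ S → c ∈ S → transpose i j c ∈ S
transpose-closed {i = i} {j} {c} i∈S j∈S c∈S with c ≟ᶠ i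
... | yes _ = j∈S
... | no _ with c ≟ᶠ j
...   | yes _ = i∈S
...   | no _  = c∈S

∈-remove⁻ : ∀ {n} {S : Subset n} {c d} → d ∈ S [ c ]≔ outside → d ≢ c × d ∈ S
∈-remove⁻ {S = S} {c} {d} d∈ = d≢c ,
  lookup⇒[]= d S (trans (sym (lookup∘update′ d≢c S outside)) ([]=⇒lookup d∈))
  where
  d≢c : d ≢ c
  d≢c refl with trans (sym ([]=⇒lookup d∈)) (lookup∘update c S outside)
  ... | ()

-- Totals, block sums and elementary moves.

module _ (A : TileSet) where
  open TileSet A
  open AGG A

  tile-cong : ∀ {x y} (a : Allowed x) (b : Allowed y) → x ≡ y →
              just {A = Tile} (x , irr a) ≡ just (y , irr b)
  tile-cong _ _ refl = refl

  total-initial : ∀ n → total (initial n) ≡ 0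
  total-initial zero    = refl
  total-initial (suc n) = total-initial n

  total-place : ∀ {n x} (a : Allowed x) c (p : Position n) → lookup p c ≡ nothing →
                total (place x a c p) ≡ x + total p
  total-place a zero (nothing ∷ p) refl = refl
  total-place {x = x} a (suc c) (t ∷ p) eq =
    trans (cong (cellValue t +_) (total-place a c p eq))
    (trans (sym (+-assoc (cellValue t) x _))
    (trans (cong (_+ total p) (+-comm (cellValue t) x)) (+-assoc x _ _)))

  support : ∀ {n} → Position n → Subset n
  support = map is-just

  support⇒nonempty : ∀ {n} (p : Position n) {c} → c ∈ support p → lookup p c ≢ nothing
  support⇒nonempty (just t ∷ p) here ()
  support⇒nonempty (t ∷ p) (there c∈) = support⇒nonempty p c∈

  support⇐nonempty : ∀ {n} (p : Position n) {c} → lookup p c ≢ nothing → c ∈ support p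
  support⇐nonempty (just t ∷ p)  {zero}  _  = here
  support⇐nonempty (nothing ∷ p) {zero}  ne = contradiction refl ne
  support⇐nonempty (t ∷ p)       {suc c} ne = there (support⇐nonempty p ne)

  sumOver-support : ∀ {n} (p : Position n) → sumOver (support p) p ≡ total p
  sumOver-support []            = refl
  sumOver-support (just t ∷ p)  = cong (_ +_) (sumOver-support p)
  sumOver-support (nothing ∷ p) = sumOver-support p

  sumOver-full : ∀ {n} (p : Position n) → sumOver full p ≡ total p
  sumOver-full []      = refl
  sumOver-full (t ∷ p) = cong (cellValue t +_) (sumOver-full p)

  sumOver-empty : ∀ {n} (S : Subset n) p → (∀ c → c ∉ S) → sumOver S p ≡ 0
  sumOver-empty []            []      _ = refl
  sumOver-empty (inside ∷ S)  (t ∷ p) e = contradiction here (e zero)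
  sumOver-empty (outside ∷ S) (t ∷ p) e = sumOver-empty S p (λ c → e (suc c) ∘ there)

  sumOver-remove : ∀ {n} {S : Subset n} {c} p → c ∈ S →
                   sumOver S p ≡ cellValue (lookup p c) + sumOver (S [ c ]≔ outside) p
  sumOver-remove (t ∷ p) here = refl
  sumOver-remove {S = outside ∷ S} (t ∷ p) (there c∈S) = sumOver-remove p c∈S
  sumOver-remove {S = inside ∷ S} {suc c} (t ∷ p) (there c∈S) =
    trans (cong (cellValue t +_) (sumOver-remove p c∈S))
    (trans (sym (+-assoc (cellValue t) v rest))
    (trans (cong (_+ rest) (+-comm (cellValue t) v)) (+-assoc v _ rest)))
    where
    v    = cellValue (lookup p c)
    rest = sumOver (S [ c ]≔ outside) p

  Merges-refl : ∀ {n} (p : Position n) → Merges p p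
  Merges-refl p = record
    { k = 0 ; S = λ () ; disjoint = λ () ; nonempty = λ () ; allowed = λ ()
    ; r = λ () ; r∈S = λ () ; merged = λ () ; emptied = λ ()
    ; untouched = λ _ _ → refl }

  -- Cell zero lies outside every block, so a tile can stay parked there while play goes on in the
  -- other cells.
  Merges-∷ : ∀ {n} t {p q : Position n} → Merges p q → Merges (t ∷ p) (t ∷ q)
  Merges-∷ t m = record
    { k         = k
    ; S         = λ i → outside ∷ S i
    ; disjoint  = λ { i j i≢j (suc c , there c∈) → disjoint i j i≢j (c , c∈) }
    ; nonempty  = λ { i (suc c) (there c∈) → nonempty i c c∈ }
    ; allowed   = allowed
    ; r         = suc ∘ r
    ; r∈S       = there ∘ r∈S
    ; merged    = merged
    ; emptied   = λ { i (suc c) (there c∈) c≢ → emptied i c c∈ (c≢ ∘ cong suc) }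
    ; untouched = λ { zero _ → refl ; (suc c) c∉ → untouched c (λ i → c∉ i ∘ there) }
    }
    where open Merges m

  Step-∷ : ∀ {n} t {p q : Position n} → Step p q → Step (t ∷ p) (t ∷ q)
  Step-∷ t (c , empty , m) = suc c , empty , Merges-∷ t m

  -- A single block suffices. It is `support p` and not `full`, because a block may not contain
  -- empty cells.
  Merges-all : ∀ {n y} (p : Position (suc n)) (a : Allowed y) → lookup p zero ≢ nothing →
               total p ≡ y → Merges p (place y a zero (initial (suc n)))
  Merges-all {n} {y} p a ne total≡y = record
    { k         = 1
    ; S         = λ _ → support p
    ; disjoint  = λ { zero zero 0≢0 → contradiction refl 0≢0 }
    ; nonempty  = λ _ _ → support⇒nonempty p
    ; allowed   = λ _ → subst Allowed (sym sum≡y) a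
    ; r         = λ _ → zero
    ; r∈S       = λ _ → support⇐nonempty p ne
    ; merged    = λ _ → tile-cong a (subst Allowed (sym sum≡y) a) (sym sum≡y)
    ; emptied   = λ { _ zero _ 0≢0 → contradiction refl 0≢0
                    ; _ (suc c) _ _ → lookup-replicate c nothing }
    ; untouched = λ
      { zero    c∉ → contradiction (support⇐nonempty p ne) (c∉ zero)
      ; (suc c) c∉ → trans (lookup-replicate c nothing) (sym (outside⇒nothing c (c∉ zero))) }
    }
    where
    sum≡y : sumOver (support p) p ≡ y
    sum≡y = trans (sumOver-support p) total≡y

    outside⇒nothing : ∀ c → suc c ∉ support p → lookup p (suc c) ≡ nothing
    outside⇒nothing c c∉ with lookup p (suc c) in eq
    ... | nothing = refl
    ... | just _  = contradiction (support⇐nonempty p λ e → contradiction (trans (sym eq) e) λ ()) c∉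

-- Least elements and suprema under excluded middle.

module _ (em : ExcludedMiddle 0ℓ) where
  open Classical em

  greatest≤ : ∀ {P : Pred ℕ 0ℓ} {a} → P a → ∀ v → a ≤ v →
              ∃[ m ] P m × m ≤ v × (∀ k → P k → k ≤ v → k ≤ m)
  greatest≤ {P} Pa v a≤v with em {P v}
  ... | yes Pv = v , Pv , ≤-refl , λ _ _ → id
  greatest≤ Pa zero z≤n | no ¬P0 = contradiction Pa ¬P0
  greatest≤ {P} Pa (suc v) a≤v | no ¬Pv
    with greatest≤ Pa v (s≤s⁻¹ (≤∧≢⇒< a≤v λ { refl → ¬Pv Pa }))
  ... | m , Pm , m≤v , max = m , Pm , m≤n⇒m≤1+n m≤v ,
    λ k Pk k≤v → max k Pk (s≤s⁻¹ (≤∧≢⇒< k≤v λ { refl → ¬Pv Pk }))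

  well-ordering : ∀ {P} a → P a → ∃ (IsSmallest P)
  well-ordering {P} = <-rec _ λ a rec Pa → step a rec Pa (em {∃[ b ] b < a × P b})
    where
    step : ∀ a → (∀ {b} → b < a → P b → ∃ (IsSmallest P)) → P a →
           Dec (∃[ b ] b < a × P b) → ∃ (IsSmallest P)
    step a rec Pa (yes (b , b<a , Pb)) = rec b<a Pb
    step a rec Pa (no ¬b) = a , Pa , λ k Pk → ≮⇒≥ (λ k<a → ¬b (k , k<a , Pk))

  -- By well-ordering, `⊤⁺` can be tied to emptiness of `P`, the form that later arguments use, and
  -- not merely to the lack of a least element.
  data SmallestView (P : Pred ℕ 0ℓ) : ℕ ⁺ → Set where
    found  : ∀ {m} → IsSmallest P m → SmallestView P [ m ]
    absent : ¬ ∃ P → SmallestView P ⊤⁺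

  smallest-view : ∀ P → SmallestView P (smallest P)
  smallest-view P = view em
    where
    view : ∀ d → SmallestView P (fromSmallest d)
    view (yes (_ , least)) = found least
    view (no ¬least)       = absent λ (a , Pa) → ¬least (well-ordering a Pa)

  -- The second hypothesis serves both cases: for `s = [ k ]` the choice `v = k` puts every bound
  -- above `k`; for `s = ⊤⁺` the choice `v = suc b` refutes a bound `b`.
  sup-unique : ∀ {P s} → (∀ x → P x → [ x ] ≤⁺ s) →
               (∀ v → [ v ] ≤⁺ s → ∃[ x ] P x × v ≤ x) → sup P ≡ s
  sup-unique {P} {s} upper reached with sup P | smallest-view (UpperBound P)
  sup-unique {P} {[ k ]} upper reached | [ b ] | found (bound , least) =
    cong [_] (≤-antisym (least k λ x Px → [≤]-injective (upper x Px)) k≤b)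
    where
    k≤b : k ≤ b
    k≤b with x , Px , k≤x ← reached k ≤⁺-refl = ≤-trans k≤x (bound x Px)
  sup-unique {P} {⊤⁺} upper reached | [ b ] | found (bound , _)
    with x , Px , b<x ← reached (suc b) (_ ≤⊤⁺) =
    contradiction (bound x Px) (<⇒≱ b<x)
  sup-unique {P} {[ k ]} upper reached | ⊤⁺ | absent none =
    contradiction (k , λ x Px → [≤]-injective (upper x Px)) none
  sup-unique {P} {⊤⁺} upper reached | ⊤⁺ | absent none = refl

  -- The recursive bounds and their relation to gaps.

  module _ (A : TileSet) where
    open TileSet A
    open AGG A

    -- `capacity n` is T n and `peak n` below is S n, both defined without the game. They turn out
    -- to be `Total A n` and, with a shifted index, `Single A (suc n)`.
    capacity : ℕ → ℕ ⁺
    capacity zero    = [ 0 ]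
    capacity (suc n) = smallest (GapExceeds A (capacity n)) +⁺ capacity n

    peak : ℕ → ℕ ⁺
    peak n = smallest (GapExceeds A (capacity n))

    peak-view : ∀ n → SmallestView (GapExceeds A (capacity n)) (peak n)
    peak-view n = smallest-view _

    peak≥1 : ∀ n → [ 1 ] ≤⁺ peak n
    peak≥1 n with peak n | peak-view n
    ... | _ | found ((a , _) , _) = [ positive a ]
    ... | _ | absent _            = _ ≤⊤⁺

    gap-upper : ∀ {t y z} → Allowed z → y < z → t <⁺ gap A y → t <⁺ [ z ∸ y ]
    gap-upper {y = y} {z} z∈A y<z t<gap
      with smallest (λ x → Allowed x × y < x) | smallest-view (λ x → Allowed x × y < x)
    gap-upper {y = y} z∈A y<z [ k<gap ] | _ | found (_ , least) =
      [ <-≤-trans k<gap (∸-monoˡ-≤ y (least _ (z∈A , y<z))) ]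
    ... | _ | absent none = contradiction (_ , z∈A , y<z) none

    -- The last hypothesis puts the successor of `y` at `suc v` or later, so `suc (v ∸ y)` is at
    -- most the gap, which is at most `t`. Without a successor the gap would be infinite and exceed
    -- any finite `t`.
    gap-lower : ∀ {t y v} → ¬ t <⁺ gap A y → y ≤ v →
                (∀ z → Allowed z → z ≤ v → z ≤ y) → [ suc (v ∸ y) ] ≤⁺ t
    gap-lower {⊤⁺} _ _ _ = _ ≤⊤⁺
    gap-lower {[ k ]} {y} {v} k≮gap y≤v max
      with smallest (λ x → Allowed x × y < x) | smallest-view (λ x → Allowed x × y < x)
    ... | _ | absent _ = contradiction [ k ]<⊤⁺ k≮gap
    ... | _ | found {m} ((m∈A , y<m) , _) = [ begin
      suc (v ∸ y)  ≡⟨ +-∸-assoc 1 y≤v ⟨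
      suc v ∸ y    ≤⟨ ∸-monoˡ-≤ y (≰⇒> λ m≤v → <⇒≱ y<m (max m m∈A m≤v)) ⟩
      m ∸ y        ≤⟨ ≮⇒≥ (k≮gap ∘ [_]) ⟩
      k            ∎ ]
      where open ≤-Reasoning

    below-peak : ∀ n {y} → Allowed y → [ suc y ] ≤⁺ peak n → ¬ capacity n <⁺ gap A y
    below-peak n y∈A y<peak exceeds with peak n | peak-view n | y<peak
    ... | _ | found (_ , least) | [ y<m ] = <⇒≱ y<m (least _ (y∈A , exceeds))
    ... | _ | absent none       | _       = none (_ , y∈A , exceeds)

    -- An allowed `z` above a finite peak `x` would give `z ∸ x ≥ gap x > capacity n`, against
    -- `z ≤ x + capacity n`.
    allowed≤capacity⇒≤peak : ∀ n {z} → Allowed z → [ z ] ≤⁺ capacity (suc n) → [ z ] ≤⁺ peak n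
    allowed≤capacity⇒≤peak n {z} z∈A z≤cap with peak n | peak-view n
    ... | _ | absent _ = _ ≤⊤⁺
    ... | _ | found {x} ((_ , exceeds) , _) = bound (capacity n) z≤cap exceeds
      where
      bound : ∀ t → [ z ] ≤⁺ [ x ] +⁺ t → t <⁺ gap A x → [ z ] ≤⁺ [ x ]
      bound t z≤x+t t<gap with z ≤? x
      ... | yes z≤x = [ z≤x ]
      ... | no z≰x with gap-upper z∈A (≰⇒> z≰x) t<gap | z≤x+t
      ...   | [ k<z∸x ] | [ z≤x+k ] = contradiction (m≤n+o⇒m∸n≤o z x z≤x+k) (<⇒≱ k<z∸x)

    -- Upper bounds

    -- Induction on `M`. By injectivity at most one cell of `S` has level `M`; it contributes at
    -- most `peak M`, and the other cells have levels below `M`.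
    sumOver≤capacity : ∀ {n} M (S : Subset n) p {level : Fin n → ℕ} → Injective _≡_ _≡_ level →
                       (∀ c → [ cellValue (lookup p c) ] ≤⁺ peak (level c)) →
                       (∀ c → c ∈ S → level c < M) → [ sumOver S p ] ≤⁺ capacity M
    sumOver≤capacity zero S p inj le below =
      [ ≤-reflexive (sumOver-empty A S p λ c c∈S → n≮0 (below c c∈S)) ]
    sumOver≤capacity (suc M) S p {level} inj le below
      with any? (λ c → c ∈? S ×-dec level c ≟ M)
    ... | yes (c , c∈S , eq) = subst (λ v → [ v ] ≤⁺ capacity (suc M))
      (sym (sumOver-remove A p c∈S))
      (+⁺-mono-≤⁺ (subst (λ l → [ _ ] ≤⁺ peak l) eq (le c))
        (sumOver≤capacity M (S [ c ]≔ outside) p inj le below′))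
      where
      below′ : ∀ d → d ∈ S [ c ]≔ outside → level d < M
      below′ d d∈ with d≢c , d∈S ← ∈-remove⁻ d∈ = ≤∧≢⇒< (s≤s⁻¹ (below d d∈S)) λ eq′ → d≢c (inj (trans eq′ (sym eq)))
    ... | no none = +⁺-mono-≤⁺ {0} (≤⁺-trans ≤-trans [ z≤n ] (peak≥1 M))
      (sumOver≤capacity M S p inj le λ c c∈S →
        ≤∧≢⇒< (s≤s⁻¹ (below c c∈S)) λ eq → none (c , c∈S , eq))

    -- Empty cells carry levels too, with value 0, so placing a 1 changes no level: every peak is at
    -- least 1.
    record Levelled {n} (p : Position n) : Set where
      field
        level     : Fin n → ℕ
        level<n   : ∀ c → level c < n
        injective : Injective _≡_ _≡_ level
        value≤    : ∀ c → [ cellValue (lookup p c) ] ≤⁺ peak (level c)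

    initial-levelled : ∀ n → Levelled (initial n)
    initial-levelled n = record
      { level = toℕ ; level<n = toℕ<n ; injective = toℕ-injective ; value≤ = le }
      where
      le : ∀ c → [ cellValue (lookup (initial n) c) ] ≤⁺ peak (toℕ c)
      le c rewrite lookup-replicate {n = n} c (nothing {A = Tile}) =
        ≤⁺-trans ≤-trans [ z≤n ] (peak≥1 (toℕ c))

    place-levelled : ∀ {n} c {p : Position n} → Levelled p → Levelled (place 1 one c p)
    place-levelled c {p} lev = record
      { level = level ; level<n = level<n ; injective = injective ; value≤ = le }
      where
      open Levelled lev
      le : ∀ d → [ cellValue (lookup (place 1 one c p) d) ] ≤⁺ peak (level d)
      le d with d ≟ᶠ c
      ... | yes refl rewrite lookup∘update c p (just (1 , irr one)) = peak≥1 (level c)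
      ... | no d≢c rewrite lookup∘update′ d≢c p (just (1 , irr one)) = value≤ d

    -- In each block the result cell `r i` and the highest cell `top i` exchange levels. The merged
    -- tile thus gets the highest level; the other cells of the block are now empty, so any level
    -- suits them.
    merge-levelled : ∀ {n} {p q : Position n} → Merges p q → Levelled p → Levelled q
    merge-levelled {n} {p} {q} m lev = record
      { level = level ∘ swap ; level<n = level<n ∘ swap
      ; injective = swap-injective ∘ injective ; value≤ = le }
      where
      open Merges m
      open Levelled lev

      highest : ∀ i → ∃[ c ] c ∈ S i × (∀ d → d ∈ S i → level d ≤ level c)
      highest i
        with _ , (c , c∈S , refl) , _ , max ←
             greatest≤ {λ l → ∃[ c ] c ∈ S i × level c ≡ l}
               (r i , r∈S i , refl) n (<⇒≤ (level<n (r i)))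
        = c , c∈S , λ d d∈S → max _ (d , d∈S , refl) (<⇒≤ (level<n d))

      top : ∀ i → Fin n
      top i = proj₁ (highest i)

      sum≤peak : ∀ i → [ sumOver (S i) p ] ≤⁺ peak (level (top i))
      sum≤peak i = allowed≤capacity⇒≤peak (level (top i)) (allowed i)
        (sumOver≤capacity (suc (level (top i))) (S i) p injective value≤
          λ d d∈S → s≤s (proj₂ (proj₂ (highest i)) d d∈S))

      same-block : ∀ {i j c} → c ∈ S i → c ∈ S j → i ≡ j
      same-block {i} {j} {c} c∈i c∈j with i ≟ᶠ j
      ... | yes eq  = eq
      ... | no i≢j = contradiction (c , x∈p∩q⁺ (c∈i , c∈j)) (disjoint i j i≢j)

      swap-block : ∀ i → Fin n → Fin n
      swap-block i = transpose (r i) (top i)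

      swap-block-∈ : ∀ {i c} → c ∈ S i → swap-block i c ∈ S i
      swap-block-∈ {i} = transpose-closed (r∈S i) (proj₁ (proj₂ (highest i)))

      block? : ∀ c → Dec (∃[ i ] c ∈ S i)
      block? c = any? (λ i → c ∈? S i)

      swap : Fin n → Fin n
      swap c with block? c
      ... | yes (i , _) = swap-block i c
      ... | no _        = c

      -- `swap` maps each block into itself and fixes all cells outside the blocks. Equal images
      -- therefore lie in the same block, where `swap` is a transposition, or outside all blocks.
      swap-injective : Injective _≡_ _≡_ swap
      swap-injective {c} {d} eq with block? c | block? d
      ... | no _ | no _ = eq
      ... | no c∉ | yes (j , d∈) =
        contradiction (j , subst (_∈ S j) (sym eq) (swap-block-∈ d∈)) c∉
      ... | yes (i , c∈) | no d∉ =
        contradiction (i , subst (_∈ S i) eq (swap-block-∈ c∈)) d∉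
      ... | yes (i , c∈) | yes (j , d∈)
        with refl ← same-block (swap-block-∈ c∈)
                      (subst (_∈ S j) (sym eq) (swap-block-∈ d∈))
        = transpose-injective (r i) (top i) eq

      le : ∀ c → [ cellValue (lookup q c) ] ≤⁺ peak (level (swap c))
      le c with block? c
      ... | no c∉ rewrite untouched c (λ i c∈ → c∉ (i , c∈)) = value≤ c
      ... | yes (i , c∈) with c ≟ᶠ r i
      ...   | no c≢r rewrite emptied i c c∈ c≢r =
        ≤⁺-trans ≤-trans [ z≤n ] (peak≥1 (level _))
      ...   | yes refl rewrite merged i = sum≤peak i

    reachable-levelled : ∀ {n} {p : Position n} → Reachable p → Levelled p
    reachable-levelled {n} = go (initial-levelled n)
      where
      go : ∀ {p q : Position n} → Levelled p → Star Step p q → Levelled q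
      go lev ε                      = lev
      go lev ((c , _ , m) ◅ steps) = go (merge-levelled m (place-levelled c lev)) steps

    reachable⇒total≤capacity : ∀ {n} {p : Position n} → Reachable p → [ total p ] ≤⁺ capacity n
    reachable⇒total≤capacity {n} {p} reach =
      subst (λ v → [ v ] ≤⁺ capacity n) (sumOver-full A p)
        (sumOver≤capacity n full p injective value≤ λ c _ → level<n c)
      where open Levelled (reachable-levelled reach)

    -- The lone tile is the whole total, so it is at most `capacity (suc n)`; being allowed, it
    -- drops to `peak n`.
    reachable⇒single≤peak : ∀ n x → ReachableSingle (suc n) x → [ x ] ≤⁺ peak n
    reachable⇒single≤peak n x (x∈A , c , reach) = allowed≤capacity⇒≤peak n x∈A
      (subst (λ v → [ v ] ≤⁺ capacity (suc n)) total≡x (reachable⇒total≤capacity reach))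
      where
      total≡x : total (place x x∈A c (initial (suc n))) ≡ x
      total≡x = trans (total-place A x∈A c (initial (suc n)) (lookup-replicate c nothing))
        (trans (cong (x +_) (total-initial A n)) (+-identityʳ x))

    -- Lower bounds

    -- The empty cell leaves room for one more 1, which raises the total to `suc v`. Hence the bound
    -- on `suc v`, not `v`, below.
    Extendable : ∀ n → ℕ → Set
    Extendable n v = ∃[ p ] Reachable {n} p × total p ≡ v × ∃[ c ] lookup p c ≡ nothing

    -- Strong induction on `y`: build the preceding allowed value in cell zero, then all but 1 of
    -- the difference in the other cells; the last 1 completes `y`, and everything merges. The
    -- hypothesis `extend` lets `extendable` recurse on `n`.
    single-reachable : ∀ n → (∀ v → [ suc v ] ≤⁺ capacity n → Extendable n v) →
                       ∀ y (a : Allowed y) → [ y ] ≤⁺ peak n →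
                       Reachable (place y a zero (initial (suc n)))
    single-reachable n extend = <-rec _ build
      where
      build : ∀ y → (∀ {z} → z < y → (a : Allowed z) → [ z ] ≤⁺ peak n →
                     Reachable (place z a zero (initial (suc n)))) →
              (a : Allowed y) → [ y ] ≤⁺ peak n → Reachable (place y a zero (initial (suc n)))
      build zero          rec a y≤ = contradiction (positive a) n≮0
      build (suc zero)    rec a y≤ = (zero , refl , Merges-refl A _) ◅ ε
      build (suc v@(suc _)) rec a y≤
        -- As `y = suc v`, this `y₀` is the predecessor of `y`. It lies below `peak n`, so its gap
        -- does not exceed `capacity n`.
        with y₀ , y₀∈A , y₀≤v , max ← greatest≤ {Allowed} one v (s≤s z≤n)
        with p , reach , total≡ , c , empty ← extend (v ∸ y₀)
               (gap-lower (below-peak n y₀∈A (≤⁺-trans ≤-trans [ s≤s y₀≤v ] y≤)) y₀≤v max)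
        = rec (s≤s y₀≤v) y₀∈A (≤⁺-trans ≤-trans [ m≤n⇒m≤1+n y₀≤v ] y≤)
          ◅◅ gmap (just (y₀ , irr y₀∈A) ∷_) (Step-∷ A _) reach
          ◅◅ (suc c , empty , Merges-all A _ a (λ ()) total≡suc) ◅ ε
        where
        total≡suc : y₀ + total (place 1 one c p) ≡ suc v
        total≡suc = trans (cong (y₀ +_) (trans (total-place A one c p empty) (cong suc total≡)))
          (trans (+-suc y₀ _) (cong suc (m+[n∸m]≡n y₀≤v)))

    -- For positive `v`, cell zero receives the smaller of `peak n` and the greatest allowed value
    -- up to `v`; the remainder is left to the other `n` cells.
    extendable : ∀ n v → [ suc v ] ≤⁺ capacity n → Extendable n v
    extendable zero    v    [ () ]
    extendable (suc n) zero _ = initial (suc n) , ε , total-initial A (suc n) , zero , refl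
    extendable (suc n) v@(suc _) v<
      with y , y∈A , y≤v , max ← greatest≤ {Allowed} one v (s≤s z≤n)
      = choose (peak n) (peak-view n) id v<
      where
      withTile : ∀ {y} → Allowed y → [ y ] ≤⁺ peak n → y ≤ v →
                 [ suc (v ∸ y) ] ≤⁺ capacity n → Extendable (suc n) v
      withTile {y} y∈A y≤ y≤v rest
        with p , reach , total≡ , c , empty ← extendable n (v ∸ y) rest
        = just (y , irr y∈A) ∷ p
        , single-reachable n (extendable n) y y∈A y≤ ◅◅ gmap (_ ∷_) (Step-∷ A _) reach
        , trans (cong (y +_) total≡) (m+[n∸m]≡n y≤v)
        , suc c , empty

      remainder : ∀ {x} t → x ≤ v → [ suc v ] ≤⁺ [ x ] +⁺ t → [ suc (v ∸ x) ] ≤⁺ t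
      remainder ⊤⁺    _   _     = _ ≤⊤⁺
      remainder {x} [ k ] x≤v [ le ] =
        [ subst (_≤ k) (+-∸-assoc 1 x≤v) (m≤n+o⇒m∸n≤o (suc v) x le) ]

      choose : ∀ s → SmallestView (GapExceeds A (capacity n)) s →
               (∀ {y} → [ y ] ≤⁺ s → [ y ] ≤⁺ peak n) →
               [ suc v ] ≤⁺ s +⁺ capacity n → Extendable (suc n) v
      choose _ (absent _) to-peak _ =
        withTile y∈A (to-peak (_ ≤⊤⁺)) y≤v (gap-lower (below-peak n y∈A (to-peak (_ ≤⊤⁺))) y≤v max)
      choose _ (found {x} ((x∈A , _) , _)) to-peak v<x+t with x ≤? y
      -- If the peak `x` fits under `v`, the remainder is bounded through `suc v ≤ x + capacity n`.
      -- Otherwise `y` lies below the peak, so its gap is at most `capacity n`, and `v ∸ y` is less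
      -- than that gap.
      ... | yes x≤y = withTile x∈A (to-peak ≤⁺-refl) (≤-trans x≤y y≤v)
              (remainder (capacity n) (≤-trans x≤y y≤v) v<x+t)
      ... | no x≰y = withTile y∈A (to-peak [ <⇒≤ (≰⇒> x≰y) ]) y≤v
              (gap-lower (below-peak n y∈A (to-peak [ ≰⇒> x≰y ])) y≤v max)

    -- Stop one short of the target with a cell still empty, then place a last 1 without merging.
    total-reached : ∀ n v → [ v ] ≤⁺ capacity n → ReachableTotal n v
    total-reached n zero    _  = initial n , ε , total-initial A n
    total-reached n (suc v) v< with p , reach , total≡ , c , empty ← extendable n v v<
      = place 1 one c p , reach ◅◅ (c , empty , Merges-refl A _) ◅ ε
      , trans (total-place A one c p empty) (cong suc total≡)

    -- Infinite values.

    Unbounded : Set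
    Unbounded = ∀ v → ∃[ y ] Allowed y × v ≤ y

    -- Every allowed value has a gap of at most `k`, hence a successor; climbing successors passes
    -- any `v`.
    no-gap-exceeds⇒unbounded : ∀ {k} → ¬ ∃ (GapExceeds A [ k ]) → Unbounded
    no-gap-exceeds⇒unbounded none zero = 1 , one , z≤n
    no-gap-exceeds⇒unbounded {k} none (suc v)
      with y , y∈A , v≤y ← no-gap-exceeds⇒unbounded none v
      with smallest (λ x → Allowed x × y < x)
         | smallest-view (λ x → Allowed x × y < x)
         -- Carrying this refutation through the `with` makes its hidden `gap A y` reduce in each
         -- case.
         | (λ lt → none (y , y∈A , lt))
    ... | _ | found {m} ((m∈A , y<m) , _) | _ = m , m∈A , ≤-<-trans v≤y y<m
    ... | _ | absent _ | ¬lt = contradiction [ k ]<⊤⁺ ¬lt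

    -- Descend to the first infinite capacity. The one before it is finite, so the infinite summand
    -- is the peak, and no gap exceeds that finite value.
    capacity-infinite⇒unbounded : ∀ n → capacity n ≡ ⊤⁺ → Unbounded
    capacity-infinite⇒unbounded (suc n) eq
      with capacity n in eqₙ | smallest (GapExceeds A (capacity n)) | peak-view n
    ... | ⊤⁺    | _ | _           = capacity-infinite⇒unbounded n eqₙ
    ... | [ k ] | _ | absent none = no-gap-exceeds⇒unbounded none

    single-reached : ∀ n v → [ v ] ≤⁺ peak n → ∃[ x ] ReachableSingle (suc n) x × v ≤ x
    single-reached n v v≤ = choose (peak n) (peak-view n) refl v≤
      where
      choose : ∀ s → SmallestView (GapExceeds A (capacity n)) s → peak n ≡ s →
               [ v ] ≤⁺ s → ∃[ x ] ReachableSingle (suc n) x × v ≤ x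
      choose _ (found {x} ((x∈A , _) , _)) eq [ v≤x ] =
        x , (x∈A , zero , single-reachable n (extendable n) x x∈A
                            (subst ([ x ] ≤⁺_) (sym eq) ≤⁺-refl)) , v≤x
      choose _ (absent _) eq _
        -- An infinite peak is not itself a tile; unboundedness supplies an allowed `y` beyond `v`,
        -- and every allowed value is reachable here.
        with y , y∈A , v≤y ←
             capacity-infinite⇒unbounded (suc n) (cong (_+⁺ capacity n) eq) v
        = y , (y∈A , zero , single-reachable n (extendable n) y y∈A
                              (subst ([ y ] ≤⁺_) (sym eq) (_ ≤⊤⁺))) , v≤y

    -- Identification of the game values with the recursion.

    Single≡peak : ∀ n → Single A (suc n) ≡ peak n
    Single≡peak n = sup-unique (reachable⇒single≤peak n) (single-reached n)

    Total≡capacity : ∀ n → Total A n ≡ capacity n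
    Total≡capacity zero      = refl
    Total≡capacity n@(suc _) = sup-unique
      (λ { _ (p , reach , refl) → reachable⇒total≤capacity reach })
      (λ v v≤ → v , total-reached n v v≤ , ≤-refl)

    Total-suc : ∀ n → Total A (suc n) ≡ Single A (suc n) +⁺ Total A n
    Total-suc n = trans (Total≡capacity (suc n))
      (sym (cong₂ _+⁺_ (Single≡peak n) (Total≡capacity n)))

    Total≡sum⁺ : ∀ n → Total A n ≡ sum⁺ (Single A ∘ suc) n
    Total≡sum⁺ zero    = refl
    Total≡sum⁺ (suc n) = trans (Total-suc n)
      (trans (cong (Single A (suc n) +⁺_) (Total≡sum⁺ n)) (sym (sum⁺-suc (Single A ∘ suc) n)))

    Single≡smallest : ∀ n → Single A (suc n) ≡ smallest (GapExceeds A (Total A n))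
    Single≡smallest n =
      trans (Single≡peak n) (cong (smallest ∘ GapExceeds A) (sym (Total≡capacity n)))

mainTheorem7 : (em : ExcludedMiddle 0ℓ) (A : TileSet) (n : ℕ) →
    let open Classical em in
    ( (∃[ x ] (IsSmallest (GapExceeds A (Total A n)) x × Single A (suc n) ≡ [ x ]))
    ⊎ ((¬ ∃ (GapExceeds A (Total A n))) × Single A (suc n) ≡ ⊤⁺ × Total A (suc n) ≡ ⊤⁺) )
    × Total A (suc n) ≡ Single A (suc n) +⁺ Total A n
    × Total A (suc n) ≡ sum⁺ (Single A ∘ suc) (suc n)
mainTheorem7 em A n =
  cases (smallest-view em _) (Single≡smallest em A n) , Total-suc em A n , Total≡sum⁺ em A (suc n)
  where
  open Classical em
  cases : ∀ {s} → SmallestView em (GapExceeds A (Total A n)) s → Single A (suc n) ≡ s →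
          (∃[ x ] (IsSmallest (GapExceeds A (Total A n)) x × Single A (suc n) ≡ [ x ]))
          ⊎ ((¬ ∃ (GapExceeds A (Total A n))) × Single A (suc n) ≡ ⊤⁺ × Total A (suc n) ≡ ⊤⁺)
  cases (found {x} least) eq = inj₁ (x , least , eq)
  cases (absent none)     eq =
    inj₂ (none , eq , trans (Total-suc em A n) (cong (_+⁺ Total A n) eq))
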